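{- Let $G$ be a finite, simple, undirected graph. If $G$ is connected and claw-free, then $Z_+(G) = Z(G)$, where $Z(G)$ is the standard (zero) forcing number of $G$ and $Z_+(G)$ is the positive semidefinite (zero) forcing number of $G$.
   Context: All graphs are finite, simple and undirected. A graph is claw-free if it has no induced subgraph isomorphic to $K_{1,3}$. Forcing process: the vertex set is partitioned as $V(G) = B \cup W$ into blue vertices $B$ and white vertices $W$. A color change rule specifies when a blue vertex $u \in B$ may force a white vertex $v \in W$ to become blue. At each time step some set of valid forces (with respect to the current coloring) is performed, no white vertex being forced by more than one vertex, and the forced vertices are moved from $W$ to $B$. This is repeated until no further color changes are possible. If all vertices of $G$ are then blue, the initial set $B$ is called a forcing set of $G$ under the given rule. Standard forcing rule: a blue vertex $u$ may force a white vertex $v$ if $v$ is the only white neighbor of $u$ in $G$. $Z(G)$ is the minimum cardinality of a forcing set under this rule (a standard forcing set). Positive semidefinite forcing rule: a blue vertex $u$ may force a white vertex $v$ if $v$ is the only neighbor of $u$ in the connected component of the induced subgraph $G[W]$ that contains $v$, where $W$ is the current set of white vertices. $Z_+(G)$ is the minimum cardinality of a forcing set under this rule (a positive semidefinite forcing set). -}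

module Defs where

open import Data.Nat.Base using (ℕ; suc; _≤_; _<_)
open import Data.Nat.Properties using (_<?_; ≮⇒≥)
open import Data.Nat.Induction using (<-wellFounded)
open import Data.Fin.Base using (Fin; zero; suc)
open import Data.Fin.Properties using (_≟_; any?; all?)
open import Data.Fin.Subset
  using (Subset; _∈_; _∉_; _⊆_; _∪_; ⁅_⁆; ∁; ⊤; ∣_∣; _⊃_)
open import Data.Fin.Subset.Properties
  using (_∈?_; ∈⊤; x∈⁅x⁆; x∈⁅y⁆⇒x≡y; x∈p∪q⁺; x∈p∪q⁻; p⊆p∪q;
         x∈∁p⇒x∉p; x∉p⇒x∈∁p; p⊆q⇒∁p⊇∁q; anySubset?)
open import Data.Fin.Subset.Induction using (⊃-wellFounded)
open import Data.Maybe.Base using (Maybe; just; nothing)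
open import Data.Product using (Σ; ∃; _×_; _,_; proj₁; proj₂)
open import Data.Sum using (_⊎_; inj₁; inj₂)
open import Function using (_∘_; _⇔_; mk⇔; Equivalence; Injective)
open import Induction.WellFounded using (Acc; acc)
open import Level using (0ℓ)
open import Relation.Binary using (Rel; Decidable; Symmetric; Irreflexive)
open import Relation.Binary.PropositionalEquality using (_≡_; _≢_; refl)
open import Relation.Binary.Construct.Closure.ReflexiveTransitive
  as Star using (Star; ε; _◅_; _◅◅_)
open import Relation.Nullary using (¬_; Dec; yes; no; contradiction)
open import Relation.Nullary.Decidable using (_×-dec_; _⊎-dec_; _→-dec_; ¬?; decidable-stable)
import Relation.Nullary.Decidable as Dec

private
  variable
    n m : ℕ

------------------------------------------------------------------------
-- Graphs

record Graph (n : ℕ) : Set₁ where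
  infix 4 _~_ _~?_
  field
    _~_    : Rel (Fin n) 0ℓ
    _~?_   : Decidable _~_
    symm   : Symmetric _~_
    irrefl : Irreflexive _≡_ _~_

Connected : Graph n → Set
Connected G = ∀ u v → Star _~_ u v
  where open Graph G

IsInducedSubgraph : Graph m → Graph n → Set
IsInducedSubgraph {m} {n} H G =
  Σ (Fin m → Fin n) λ f →
    Injective _≡_ _≡_ f × (∀ i j → (i H.~ j) ⇔ (f i G.~ f j))
  where
  module H = Graph H
  module G = Graph G

K₁,_ : ∀ m → Graph (suc m)
K₁, m = record
  { _~_    = λ i j → (i ≡ zero × j ≢ zero) ⊎ (i ≢ zero × j ≡ zero)
  ; _~?_   = λ i j → ((i ≟ zero) ×-dec ¬? (j ≟ zero)) ⊎-dec (¬? (i ≟ zero) ×-dec (j ≟ zero))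
  ; symm   = λ { (inj₁ (p , q)) → inj₂ (q , p) ; (inj₂ (p , q)) → inj₁ (q , p) }
  ; irrefl = λ { refl (inj₁ (p , q)) → q p ; refl (inj₂ (p , q)) → p q }
  }

ClawFree : Graph n → Set
ClawFree G = ¬ IsInducedSubgraph (K₁, 3) G

-- Adjacency in the induced subgraph G[S], as a relation on all of Fin n.
InducedAdj : Graph n → Subset n → Rel (Fin n) 0ℓ
InducedAdj G S u v = (u ∈ S × v ∈ S) × u ~ v
  where open Graph G

-- For v ∈ S, the w with InComponent G S v w are exactly the vertices of the
-- connected component of G[S] containing v.
InComponent : Graph n → Subset n → Rel (Fin n) 0ℓ
InComponent G S = Star (InducedAdj G S)

------------------------------------------------------------------------
-- Forcing processes

-- A colouring is given by its set B of blue vertices, the white ones being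
-- ∁ B; R B u v says that u may force v when B is the set of blue vertices.
Rule : ℕ → Set₁
Rule n = Subset n → Rel (Fin n) 0ℓ

standard : Graph n → Rule n
standard G B u v =
  u ∈ B × v ∈ ∁ B × u ~ v × (∀ w → w ∈ ∁ B → u ~ w → w ≡ v)
  where open Graph G

psd : Graph n → Rule n
psd G B u v =
  u ∈ B × v ∈ ∁ B × u ~ v × (∀ w → InComponent G (∁ B) v w → u ~ w → w ≡ v)
  where open Graph G

-- One time step: forcer v ≡ just u means that u forces v, so that no vertex
-- is forced by more than one vertex.
Step : Rule n → Rel (Subset n) 0ℓ
Step {n} R B B′ =
  Σ (Fin n → Maybe (Fin n)) λ forcer →
    (∀ u v → forcer v ≡ just u → R B u v) ×
    (∀ v → v ∈ B′ ⇔ (v ∈ B ⊎ ∃ λ u → forcer v ≡ just u))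

Stalled : Rule n → Subset n → Set
Stalled R B = ∀ u v → ¬ R B u v

IsForcingSet : Rule n → Subset n → Set
IsForcingSet R B = ∃ λ D → Star (Step R) B D × Stalled R D × (∀ v → v ∈ D)

record IsForcingNumber (R : Rule n) (k : ℕ) : Set where
  field
    attained : ∃ λ B → IsForcingSet R B × ∣ B ∣ ≡ k
    minimal  : ∀ B → IsForcingSet R B → k ≤ ∣ B ∣

------------------------------------------------------------------------
-- Existence of forcing numbers
--
-- Minima over subsets are computed by exhaustive search, which needs
-- decidability of being a forcing set.  The conditions below suffice.

record IsAdmissible (R : Rule n) : Set where
  field
    dec   : ∀ B u v → Dec (R B u v)
    white : ∀ {B u v} → R B u v → v ∈ ∁ B
    mono  : ∀ {B C u v} → B ⊆ C → v ∈ ∁ C → R B u v → R C u v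

module _ (P : Subset n → Fin n → Set) where

  Grow : Rel (Subset n) 0ℓ
  Grow S T = ∃ λ v → (v ∉ S × P S v) × T ≡ S ∪ ⁅ v ⁆

  saturate : (∀ S v → Dec (P S v)) →
             ∀ S → ∃ λ D → Star Grow S D × (∀ v → P D v → v ∈ D)
  saturate P? S = go S (⊃-wellFounded S)
    where
    go : ∀ S → Acc _⊃_ S → ∃ λ D → Star Grow S D × (∀ v → P D v → v ∈ D)
    go S (acc rs) with any? (λ v → ¬? (v ∈? S) ×-dec P? S v)
    ... | no none = S , ε , λ v p → decidable-stable (v ∈? S) (λ v∉S → none (v , v∉S , p))
    ... | yes (v , v∉S , p)
        with go (S ∪ ⁅ v ⁆) (rs (p⊆p∪q ⁅ v ⁆ , v , x∈p∪q⁺ (inj₂ (x∈⁅x⁆ v)) , v∉S))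
    ...   | D , steps , sat = D , (v , (v∉S , p) , refl) ◅ steps , sat

star? : {_⟶_ : Rel (Fin n) 0ℓ} → Decidable _⟶_ → Decidable (Star _⟶_)
star? {n} {_⟶_} _⟶?_ v w = decide (saturate Next next? ⁅ v ⁆)
  where
  Next : Subset n → Fin n → Set
  Next T y = ∃ λ x → x ∈ T × x ⟶ y

  next? : ∀ T y → Dec (Next T y)
  next? T y = any? (λ x → (x ∈? T) ×-dec (x ⟶? y))

  sound : ∀ {S D} → Star (Grow Next) S D →
          (∀ y → y ∈ S → Star _⟶_ v y) → ∀ y → y ∈ D → Star _⟶_ v y
  sound ε inv = inv
  sound {S} ((y , (_ , x , x∈S , x⟶y) , refl) ◅ steps) inv = sound steps inv′
    where
    inv′ : ∀ z → z ∈ S ∪ ⁅ y ⁆ → Star _⟶_ v z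
    inv′ z z∈ with x∈p∪q⁻ S ⁅ y ⁆ z∈
    ... | inj₁ z∈S = inv z z∈S
    ... | inj₂ z∈y with refl ← x∈⁅y⁆⇒x≡y y z∈y = inv x x∈S ◅◅ (x⟶y ◅ ε)

  grows : ∀ {S D} → Star (Grow Next) S D → S ⊆ D
  grows ε = λ x∈ → x∈
  grows ((y , _ , refl) ◅ steps) = grows steps ∘ p⊆p∪q ⁅ y ⁆

  closed : ∀ {D} → (∀ y → Next D y → y ∈ D) → ∀ {x y} → x ∈ D → Star _⟶_ x y → y ∈ D
  closed sat x∈D ε = x∈D
  closed sat x∈D (e ◅ es) = closed sat (sat _ (_ , x∈D , e)) es

  decide : (∃ λ D → Star (Grow Next) ⁅ v ⁆ D × (∀ y → Next D y → y ∈ D)) → Dec (Star _⟶_ v w)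
  decide (D , steps , sat) =
    Dec.map′ (sound steps start w) (closed sat (grows steps (x∈⁅x⁆ v))) (w ∈? D)
    where
    start : ∀ y → y ∈ ⁅ v ⁆ → Star _⟶_ v y
    start y y∈ with refl ← x∈⁅y⁆⇒x≡y v y∈ = ε

module _ {R : Rule n} (adm : IsAdmissible R) where
  open IsAdmissible adm

  Forced : Subset n → Fin n → Set
  Forced B v = ∃ λ u → R B u v

  grow⇒step : ∀ {B C} → Grow Forced B C → Step R B C
  grow⇒step {B} (v , (_ , u , r) , refl) = forcer , valid , iff
    where
    forcer : Fin n → Maybe (Fin n)
    forcer w with w ≟ v
    ... | yes _ = just u
    ... | no  _ = nothing

    valid : ∀ x y → forcer y ≡ just x → R B x y
    valid x y eq with y ≟ v
    valid x y refl | yes refl = r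
    valid x y ()   | no _

    to : ∀ w → w ∈ B ∪ ⁅ v ⁆ → w ∈ B ⊎ ∃ λ x → forcer w ≡ just x
    to w w∈ with x∈p∪q⁻ B ⁅ v ⁆ w∈
    ... | inj₁ w∈B = inj₁ w∈B
    ... | inj₂ w∈v with w ≟ v
    ...   | yes _  = inj₂ (u , refl)
    ...   | no w≢v = contradiction (x∈⁅y⁆⇒x≡y v w∈v) w≢v

    from : ∀ w → (w ∈ B ⊎ ∃ λ x → forcer w ≡ just x) → w ∈ B ∪ ⁅ v ⁆
    from w (inj₁ w∈B) = x∈p∪q⁺ (inj₁ w∈B)
    from w (inj₂ (x , eq)) with w ≟ v
    from w (inj₂ (x , eq)) | yes refl = x∈p∪q⁺ (inj₂ (x∈⁅x⁆ v))
    from w (inj₂ (x , ())) | no _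

    iff : ∀ w → w ∈ B ∪ ⁅ v ⁆ ⇔ (w ∈ B ⊎ ∃ λ x → forcer w ≡ just x)
    iff w = mk⇔ (to w) (from w)

  stalled-bound : ∀ {B C D} → Stalled R D → B ⊆ D → Star (Step R) B C → C ⊆ D
  stalled-bound st B⊆D ε = B⊆D
  stalled-bound {B} {D = D} st B⊆D ((forcer , valid , iff) ◅ steps) =
    stalled-bound st next steps
    where
    next : ∀ {w} → _ → w ∈ D
    next {w} w∈ with Equivalence.to (iff w) w∈
    ... | inj₁ w∈B = B⊆D w∈B
    ... | inj₂ (u , eq) = decidable-stable (w ∈? D)
          (λ w∉D → st u w (mono B⊆D (x∉p⇒x∈∁p w∉D) (valid u w eq)))

  isForcingSet? : ∀ B → Dec (IsForcingSet R B)
  isForcingSet? B with saturate Forced (λ C v → any? (λ u → dec C u v)) B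
  ... | D , grow , sat = Dec.map′
        (λ full → D , steps , stalled , full)
        (λ { (C , run , _ , full) v → stalled-bound stalled B⊆D run (full v) })
        (all? (_∈? D))
    where
    stalled : Stalled R D
    stalled u v r = x∈∁p⇒x∉p (white r) (sat v (u , r))

    steps : Star (Step R) B D
    steps = Star.map grow⇒step grow

    grows : ∀ {S T} → Star (Grow Forced) S T → S ⊆ T
    grows ε = λ x∈ → x∈
    grows ((y , _ , refl) ◅ rest) = grows rest ∘ p⊆p∪q ⁅ y ⁆

    B⊆D : B ⊆ D
    B⊆D = grows grow

  ⊤-isForcingSet : IsForcingSet R ⊤
  ⊤-isForcingSet = ⊤ , ε , (λ u v r → x∈∁p⇒x∉p (white r) ∈⊤) , λ v → ∈⊤

  forcingNumber : ∃ (IsForcingNumber R)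
  forcingNumber = search ⊤ ⊤-isForcingSet (<-wellFounded _)
    where
    search : ∀ B → IsForcingSet R B → Acc _<_ ∣ B ∣ → ∃ (IsForcingNumber R)
    search B forcing (acc rs)
      with anySubset? (λ C → isForcingSet? C ×-dec (∣ C ∣ <? ∣ B ∣))
    ... | yes (C , forcing′ , lt) = search C forcing′ (rs lt)
    ... | no none = ∣ B ∣ , record
          { attained = B , forcing , refl
          ; minimal  = λ C forcing′ → ≮⇒≥ (λ lt → none (C , forcing′ , lt))
          }

standard-admissible : (G : Graph n) → IsAdmissible (standard G)
standard-admissible G = record
  { dec   = λ B u v → (u ∈? B) ×-dec (v ∈? ∁ B) ×-dec (u ~? v) ×-dec
                      all? (λ w → (w ∈? ∁ B) →-dec (u ~? w) →-dec (w ≟ v))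
  ; white = proj₁ ∘ proj₂
  ; mono  = λ { B⊆C v∈ (u∈ , _ , u~v , only) →
                B⊆C u∈ , v∈ , u~v , λ w w∈ → only w (p⊆q⇒∁p⊇∁q B⊆C w∈) }
  }
  where open Graph G

psd-admissible : (G : Graph n) → IsAdmissible (psd G)
psd-admissible G = record
  { dec   = λ B u v → (u ∈? B) ×-dec (v ∈? ∁ B) ×-dec (u ~? v) ×-dec
                      all? (λ w → inComponent? (∁ B) v w →-dec (u ~? w) →-dec (w ≟ v))
  ; white = proj₁ ∘ proj₂
  ; mono  = λ { B⊆C v∈ (u∈ , _ , u~v , only) →
                B⊆C u∈ , v∈ , u~v ,
                λ w c → only w (Star.map (shrink (p⊆q⇒∁p⊇∁q B⊆C)) c) }
  }
  where
  open Graph G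

  inComponent? : ∀ S → Decidable (InComponent G S)
  inComponent? S = star? (λ u v → ((u ∈? S) ×-dec (v ∈? S)) ×-dec (u ~? v))

  shrink : ∀ {S T u v} → S ⊆ T → InducedAdj G S u v → InducedAdj G T u v
  shrink S⊆T ((u∈ , v∈) , e) = (S⊆T u∈ , S⊆T v∈) , e

------------------------------------------------------------------------
-- Forcing numbers of a graph

Z-spec : (G : Graph n) → ∃ (IsForcingNumber (standard G))
Z-spec G = forcingNumber (standard-admissible G)

Z₊-spec : (G : Graph n) → ∃ (IsForcingNumber (psd G))
Z₊-spec G = forcingNumber (psd-admissible G)

Z : Graph n → ℕ
Z G = proj₁ (Z-spec G)

Z₊ : Graph n → ℕ
Z₊ G = proj₁ (Z₊-spec G)

{-# OPTIONS --safe #-}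
-- A set B percolates when every stalled superset of B is everything; this is
-- equivalent to being a forcing set.
--
-- If u forces v under the positive semidefinite rule then u may be replaced by
-- v in B.  Fix a white vertex d and let D be its white component.  If some blue
-- vertex is adjacent both to D and to another white component C, forcing in C
-- and exchanging each forcing vertex for the vertex it forces makes D strictly
-- larger after finitely many exchanges.  If there is none, but a blue vertex a
-- adjacent to D has a blue neighbour b not adjacent to D, then b is redundant,
-- since a forces it.  If there is no such pair either, D is the whole white set
-- by connectedness of G.  So some minimum positive semidefinite forcing set has
-- a connected white set, and there the two rules agree.  In a claw-free graph
-- the white set remains connected: when u forces v, the remaining white
-- neighbours of v form a clique, as none of them is adjacent to u.
module Submission where

open import Data.Nat.Base using (ℕ; suc; z≤n; s≤s; _+_; _≤_)
open import Data.Nat.Properties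
  using (≤-trans; ≤-antisym; ≤-reflexive; <⇒≱; +-suc; +-comm; +-monoʳ-≤; n≤1+n)
open import Data.Fin.Base using (Fin; zero; suc)
open import Data.Fin.Properties using (_≟_; any?)
open import Data.Fin.Subset
  using (Subset; inside; outside; _∈_; _∉_; _⊆_; _⊂_; _⊃_; _∪_; _─_; _-_; ⁅_⁆; ∁; ∣_∣)
open import Data.Fin.Subset.Properties
  using (_∈?_; x∈⁅x⁆; x∈⁅y⁆⇒x≡y; x∈p∪q⁺; x∈p∪q⁻; p⊆p∪q; x∈∁p⇒x∉p; x∉p⇒x∈∁p;
         x∉∁p⇒x∈p; ∣⁅x⁆∣≡1; p─q⊆p; x∈p∧x≢y⇒x∈p-y; x∈p⇒∣p-x∣<∣p∣)
open import Data.Fin.Subset.Induction using (⊂-wellFounded; ⊃-wellFounded)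
open import Data.Product using (∃; ∃₂; _×_; _,_; proj₁; proj₂)
open import Data.Sum using (_⊎_; inj₁; inj₂; [_,_]′)
open import Data.Vec.Base using ([]; _∷_; here; there; tabulate)
open import Data.Vec.Properties using (lookup∘tabulate; []=⇒lookup; lookup⇒[]=)
open import Function using (_∘_; id; mk⇔; Equivalence; Injective)
open import Induction.WellFounded using (Acc; acc)
open import Relation.Binary using (Decidable)
open import Relation.Binary.PropositionalEquality
  using (_≡_; _≢_; refl; sym; trans; cong; subst)
open import Relation.Binary.Construct.Closure.ReflexiveTransitive
  as Star using (Star; ε; _◅_; _◅◅_)
open import Relation.Nullary using (¬_; yes; no; does; contradiction)
open import Relation.Nullary.Decidable
  using (_×-dec_; ¬?; decidable-stable; dec-true)
open import Relation.Unary using (Pred)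
import Relation.Unary as U
open import Level using (0ℓ)
open import Defs

private
  variable
    n : ℕ

-- Subsets of a finite set and the exchange of one element for another

comprehension : {P : Pred (Fin n) 0ℓ} → U.Decidable P → Subset n
comprehension P? = tabulate (does ∘ P?)

module _ {P : Pred (Fin n) 0ℓ} (P? : U.Decidable P) where

  ∈-comprehension⁺ : ∀ {x} → P x → x ∈ comprehension P?
  ∈-comprehension⁺ {x} px =
    lookup⇒[]= x _ (trans (lookup∘tabulate (does ∘ P?) x) (dec-true (P? x) px))

  ∈-comprehension⁻ : ∀ {x} → x ∈ comprehension P? → P x
  ∈-comprehension⁻ {x} x∈
    with P? x | trans (sym (lookup∘tabulate (does ∘ P?) x)) ([]=⇒lookup x∈)
  ... | yes px | _  = px
  ... | no  _  | ()

x∈p─q⇒x∉q : ∀ {p q : Subset n} {x} → x ∈ p ─ q → x ∉ q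
x∈p─q⇒x∉q {p = inside  ∷ p} {outside ∷ q} here ()
x∈p─q⇒x∉q {p = _ ∷ p} {outside ∷ q} (there x∈) (there x∈q) = x∈p─q⇒x∉q {p = p} x∈ x∈q
x∈p─q⇒x∉q {p = _ ∷ p} {inside  ∷ q} (there x∈) (there x∈q) = x∈p─q⇒x∉q {p = p} x∈ x∈q

∣p∪q∣≤∣p∣+∣q∣ : ∀ (p q : Subset n) → ∣ p ∪ q ∣ ≤ ∣ p ∣ + ∣ q ∣
∣p∪q∣≤∣p∣+∣q∣ []            []            = z≤n
∣p∪q∣≤∣p∣+∣q∣ (outside ∷ p) (outside ∷ q) = ∣p∪q∣≤∣p∣+∣q∣ p q
∣p∪q∣≤∣p∣+∣q∣ (outside ∷ p) (inside  ∷ q) =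
  ≤-trans (s≤s (∣p∪q∣≤∣p∣+∣q∣ p q)) (≤-reflexive (sym (+-suc ∣ p ∣ ∣ q ∣)))
∣p∪q∣≤∣p∣+∣q∣ (inside  ∷ p) (outside ∷ q) = s≤s (∣p∪q∣≤∣p∣+∣q∣ p q)
∣p∪q∣≤∣p∣+∣q∣ (inside  ∷ p) (inside  ∷ q) =
  s≤s (≤-trans (∣p∪q∣≤∣p∣+∣q∣ p q) (+-monoʳ-≤ ∣ p ∣ (n≤1+n ∣ q ∣)))

exchange : Subset n → Fin n → Fin n → Subset n
exchange B u v = (B - u) ∪ ⁅ v ⁆

module _ {B : Subset n} {u v : Fin n} where

  ∣exchange∣≤ : u ∈ B → ∣ exchange B u v ∣ ≤ ∣ B ∣
  ∣exchange∣≤ u∈B = ≤-trans (∣p∪q∣≤∣p∣+∣q∣ (B - u) ⁅ v ⁆)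
    (subst (λ k → ∣ B - u ∣ + k ≤ ∣ B ∣) (sym (∣⁅x⁆∣≡1 v))
      (subst (_≤ ∣ B ∣) (+-comm 1 ∣ B - u ∣) (x∈p⇒∣p-x∣<∣p∣ u∈B)))

  v∈exchange : v ∈ exchange B u v
  v∈exchange = x∈p∪q⁺ (inj₂ (x∈⁅x⁆ v))

  ∈-exchange : ∀ {x} → x ∈ B → x ≢ u → x ∈ exchange B u v
  ∈-exchange x∈B x≢u = x∈p∪q⁺ (inj₁ (x∈p∧x≢y⇒x∈p-y x∈B x≢u))

  ∁-exchange : ∀ {x} → x ∈ ∁ B → x ≢ v → x ∈ ∁ (exchange B u v)
  ∁-exchange x∈∁ x≢v = x∉p⇒x∈∁p
    ([ x∈∁p⇒x∉p x∈∁ ∘ p─q⊆p B ⁅ u ⁆ , x≢v ∘ x∈⁅y⁆⇒x≡y v ]′ ∘ x∈p∪q⁻ (B - u) ⁅ v ⁆)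

  u∈∁exchange : u ≢ v → u ∈ ∁ (exchange B u v)
  u∈∁exchange u≢v = x∉p⇒x∈∁p
    ([ (λ u∈ → x∈p─q⇒x∉q {p = B} u∈ (x∈⁅x⁆ u)) , u≢v ∘ x∈⁅y⁆⇒x≡y v ]′
      ∘ x∈p∪q⁻ (B - u) ⁅ v ⁆)

  ∁-exchange⁻ : ∀ {x} → x ∈ ∁ (exchange B u v) → x ≢ v × (x ≡ u ⊎ x ∈ ∁ B)
  ∁-exchange⁻ {x} x∈ = (λ { refl → x∈∁p⇒x∉p x∈ v∈exchange }) , cases
    where
    cases : x ≡ u ⊎ x ∈ ∁ B
    cases with x ≟ u
    ... | yes x≡u = inj₁ x≡u
    ... | no  x≢u = inj₂ (x∉p⇒x∈∁p (λ x∈B → x∈∁p⇒x∉p x∈ (∈-exchange x∈B x≢u)))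

-- Percolating sets and their relation to forcing sets

Percolates : Rule n → Subset n → Set
Percolates R B = ∀ S → B ⊆ S → Stalled R S → ∀ v → v ∈ S

percolates-⊆ : ∀ {R : Rule n} {B C} → B ⊆ C → Percolates R B → Percolates R C
percolates-⊆ B⊆C perc S C⊆S = perc S (C⊆S ∘ B⊆C)

all-blue-percolates : ∀ {R : Rule n} {B} → (∀ x → x ∉ ∁ B) → Percolates R B
all-blue-percolates none S B⊆S _ x = B⊆S (x∉∁p⇒x∈p (none x))

step-⊆ : ∀ {R : Rule n} {B C} → Star (Step R) B C → B ⊆ C
step-⊆ ε x∈ = x∈
step-⊆ ((_ , _ , iff) ◅ steps) x∈ = step-⊆ steps (Equivalence.from (iff _) (inj₁ x∈))

module _ {R : Rule n} (adm : IsAdmissible R) where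
  open IsAdmissible adm

  forcing⇒percolates : ∀ {B} → IsForcingSet R B → Percolates R B
  forcing⇒percolates (_ , steps , _ , full) S B⊆S st v =
    stalled-bound adm st B⊆S steps (full v)

  percolates⇒forcing : ∀ {B} → Percolates R B → IsForcingSet R B
  percolates⇒forcing {B} perc
    with saturate (Forced adm) (λ C v → any? (λ u → dec C u v)) B
  ... | D , grow , sat = D , steps , stalled , perc D (step-⊆ steps) stalled
    where
    steps : Star (Step R) B D
    steps = Star.map (grow⇒step adm) grow

    stalled : Stalled R D
    stalled u v r = x∈∁p⇒x∉p (white r) (sat v (u , r))

  -- If `S` were stalled, percolation of `B` would put `y` into `S`.
  percolates-force : ∀ {B S y} → Percolates R B → B ⊆ S → y ∉ S → ∃₂ (R S)
  percolates-force {B} {S} {y} perc B⊆S y∉S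
    with any? (λ u → any? (dec S u))
  ... | yes r = r
  ... | no none = contradiction (perc S B⊆S (λ u v r → none (u , v , r)) y) y∉S

  -- A stalled superset of `B` already contains `v`: otherwise, by monotonicity of the rule, the
  -- force of `v` by `u` would still be available there.
  percolates-unforce : ∀ {B u v} → R B u v → Percolates R (B ∪ ⁅ v ⁆) → Percolates R B
  percolates-unforce {B} {u} {v} r perc S B⊆S st = perc S
    ([ B⊆S , (λ x∈ → subst (_∈ S) (sym (x∈⁅y⁆⇒x≡y v x∈)) v∈S) ]′ ∘ x∈p∪q⁻ B ⁅ v ⁆) st
    where
    v∈S : v ∈ S
    v∈S = decidable-stable (v ∈? S) (λ v∉S → st u v (mono B⊆S (x∉p⇒x∈∁p v∉S) r))

  minimal-percolating : ∀ {k} → IsForcingNumber R k →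
                        ∃ λ B → Percolates R B × ∣ B ∣ ≤ k
  minimal-percolating num with IsForcingNumber.attained num
  ... | B , forcing , eq = B , forcing⇒percolates forcing , ≤-reflexive eq

module _ (G : Graph n) where
  open Graph G

  private
    Std = standard G
    Psd = psd G
    std-adm = standard-admissible G
    psd-adm = psd-admissible G

  -- Walks and components in an induced subgraph

  abstract
    inComponent? : ∀ S → Decidable (InComponent G S)
    inComponent? S = star? (λ u v → ((u ∈? S) ×-dec (v ∈? S)) ×-dec (u ~? v))

    component : Subset n → Fin n → Subset n
    component S x = comprehension (inComponent? S x)

    ∈-component⁺ : ∀ {S x y} → InComponent G S x y → y ∈ component S x
    ∈-component⁺ {S} {x} = ∈-comprehension⁺ (inComponent? S x)

    ∈-component⁻ : ∀ {S x y} → y ∈ component S x → InComponent G S x y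
    ∈-component⁻ {S} {x} = ∈-comprehension⁻ (inComponent? S x)

  component-sym : ∀ {S x y} → InComponent G S x y → InComponent G S y x
  component-sym = Star.reverse (λ { ((a , b) , e) → (b , a) , symm e })

  component-⊆ : ∀ {S x y} → x ∈ S → InComponent G S x y → y ∈ S
  component-⊆ x∈S ε = x∈S
  component-⊆ x∈S (((_ , b) , _) ◅ c) = component-⊆ b c

  component-snoc : ∀ {S x y z} → x ∈ S → InComponent G S x y → y ~ z → z ∈ S →
                   InComponent G S x z
  component-snoc x∈S c y~z z∈S = c ◅◅ ((component-⊆ x∈S c , z∈S) , y~z) ◅ ε

  -- Carries a walk in G[`S`] over to G[`T`]. The predicate `P` is an invariant of the vertices
  -- visited and supplies what is needed to see that each edge also lies in G[`T`].
  transport : ∀ {S T} (P : Pred (Fin n) 0ℓ) →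
              (∀ {a b} → P a → InducedAdj G S a b → InducedAdj G T a b × P b) →
              ∀ {x y} → P x → InComponent G S x y → InComponent G T x y × P y
  transport P f px ε = ε , px
  transport P f px (e ◅ c) =
    let e′ , pb = f px e ; c′ , py = transport P f pb c in e′ ◅ c′ , py

  invariant : ∀ {S} (P : Pred (Fin n) 0ℓ) →
              (∀ {a b} → P a → InducedAdj G S a b → P b) →
              ∀ {x y} → P x → InComponent G S x y → P y
  invariant P f px c = proj₂ (transport P (λ pa e → e , f pa e) px c)

  -- Exchanging a forcing vertex for the vertex it forces

  -- Let C be the old white component of `v`. In C, `u` is adjacent only to `v`, which is now blue,
  -- so a white walk from `u` never enters C. Every old white neighbour of `v` lies in C, so `u` is
  -- the only neighbour of `v` in the new component of `u`.
  exchange-psd : ∀ {B u v} → Psd B u v → Psd (exchange B u v) v u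
  exchange-psd {B} {u} {v} (u∈ , v∈ , u~v , only) =
    v∈exchange {B = B} , u∈∁exchange {B = B} (λ u≡v → irrefl u≡v u~v) , symm u~v , only′
    where
    outwards : ∀ {a b} → ¬ InComponent G (∁ B) v a →
               InducedAdj G (∁ (exchange B u v)) a b → ¬ InComponent G (∁ B) v b
    outwards a∉ ((a∈ , b∈) , a~b) cb with ∁-exchange⁻ {B = B} a∈ | ∁-exchange⁻ {B = B} b∈
    ... | _ , inj₁ refl | b≢v , _ = b≢v (only _ cb a~b)
    ... | _ , inj₂ a∈∁  | _       = a∉ (component-snoc v∈ cb (symm a~b) a∈∁)

    only′ : ∀ w → InComponent G (∁ (exchange B u v)) u w → v ~ w → w ≡ u
    only′ w c v~w
      with ∁-exchange⁻ {B = B} (component-⊆ (u∈∁exchange {B = B} (λ u≡v → irrefl u≡v u~v)) c)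
    ... | _ , inj₁ w≡u = w≡u
    ... | _ , inj₂ w∈∁ = contradiction (component-snoc v∈ ε v~w w∈∁)
      (invariant (¬_ ∘ InComponent G (∁ B) v) outwards
        (λ cu → x∈∁p⇒x∉p (component-⊆ v∈ cu) u∈) c)

  -- After the exchange `v` forces `u` back, which gives a superset of `B`.
  exchange-percolates : ∀ {B u v} → Psd B u v → Percolates Psd B →
                        Percolates Psd (exchange B u v)
  exchange-percolates {B} {u} {v} r perc =
    percolates-unforce psd-adm (exchange-psd r) (percolates-⊆ incl perc)
    where
    incl : B ⊆ exchange B u v ∪ ⁅ u ⁆
    incl {x} x∈B with x ≟ u
    ... | yes refl = x∈p∪q⁺ (inj₂ (x∈⁅x⁆ u))
    ... | no  x≢u  = x∈p∪q⁺ (inj₁ (∈-exchange x∈B x≢u))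

  -- Colour everything outside the white component C of `y` blue. Percolation yields a force there,
  -- with its target in C. Its source is adjacent to C but outside it, hence already in `B`.
  force-in-component : ∀ {B y} → Percolates Psd B → y ∈ ∁ B →
                       ∃₂ λ u v → InComponent G (∁ B) y v × Psd B u v
  force-in-component {B} {y} perc y∈
    with percolates-force psd-adm {S = ∁ (component (∁ B) y)} perc
           (λ x∈B → x∉p⇒x∈∁p (λ x∈C →
             x∈∁p⇒x∉p (component-⊆ y∈ (∈-component⁻ x∈C)) x∈B))
           (λ y∈∁C → x∈∁p⇒x∉p y∈∁C (∈-component⁺ ε))
  ... | u , v , u∈ , v∈ , u~v , only = u , v , cv , u∈B , component-⊆ y∈ cv , u~v , only′
    where
    C = component (∁ B) y

    cv : InComponent G (∁ B) y v
    cv = decidable-stable (inComponent? (∁ B) y v) (λ ¬c →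
      x∈∁p⇒x∉p v∈ (x∉p⇒x∈∁p (¬c ∘ ∈-component⁻)))

    u∈B : u ∈ B
    u∈B = decidable-stable (u ∈? B) (λ u∉B →
      x∈∁p⇒x∉p u∈ (∈-component⁺ (component-snoc y∈ cv (symm u~v) (x∉p⇒x∈∁p u∉B))))

    C⊆∁∁C : C ⊆ ∁ (∁ C)
    C⊆∁∁C x∈C = x∉p⇒x∈∁p (λ x∈∁C → x∈∁p⇒x∉p x∈∁C x∈C)

    only′ : ∀ w → InComponent G (∁ B) v w → u ~ w → w ≡ v
    -- A white walk from `v` stays in C, so it survives when the vertices outside C turn blue.
    only′ w c = only w (proj₁ (transport (InComponent G (∁ B) y)
      (λ { ca ((_ , b∈) , a~b) → let cb = component-snoc y∈ ca a~b b∈ in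
             ((C⊆∁∁C (∈-component⁺ ca) , C⊆∁∁C (∈-component⁺ cb)) , a~b) , cb })
      cv c))

  -- Enlarging the white component D of a fixed vertex `d`

  record Adjacent (B : Subset n) (d r : Fin n) : Set where
    constructor adjacent
    field
      {vertex} : Fin n
      connects : InComponent G (∁ B) d vertex
      edge     : r ~ vertex

  adjacent? : ∀ B d → U.Decidable (Adjacent B d)
  adjacent? B d r with any? (λ z → inComponent? (∁ B) d z ×-dec (r ~? z))
  ... | yes (_ , c , e) = yes (adjacent c e)
  ... | no  none        = no λ { (adjacent c e) → none (_ , c , e) }

  record Enlargement (B : Subset n) (d : Fin n) : Set where
    field
      {B′}       : Subset n
      percolates : Percolates Psd B′
      size       : ∣ B′ ∣ ≤ ∣ B ∣
      white      : d ∈ ∁ B′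
      extends    : ∀ {x} → InComponent G (∁ B) d x → InComponent G (∁ B′) d x
      {fresh}    : Fin n
      unreached  : ¬ InComponent G (∁ B) d fresh
      reached    : InComponent G (∁ B′) d fresh

  module _ {B u v d} (d∈ : d ∈ ∁ B) (r : Psd B u v) (¬cv : ¬ InComponent G (∁ B) d v) where

    private
      B′ = exchange B u v

      ≢v : ∀ {x} → InComponent G (∁ B) d x → x ≢ v
      ≢v cx refl = ¬cv cx

      d∈′ : d ∈ ∁ B′
      d∈′ = ∁-exchange {B = B} d∈ (≢v ε)

    exchange-extends : ∀ {x} → InComponent G (∁ B) d x → InComponent G (∁ B′) d x
    exchange-extends c = proj₁ (transport (InComponent G (∁ B) d)
      (λ { ca ((a∈ , b∈) , a~b) → let cb = component-snoc d∈ ca a~b b∈ in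
             ((∁-exchange {B = B} a∈ (≢v ca) , ∁-exchange {B = B} b∈ (≢v cb)) , a~b) , cb })
      ε c)

    -- The forced vertex `v` lies outside D, so D stays white, and `u`, now white, is attached to
    -- it.
    exchange-enlarges : Percolates Psd B → Adjacent B d u → Enlargement B d
    exchange-enlarges perc (adjacent c u~z) = record
      { percolates = exchange-percolates r perc
      ; size       = ∣exchange∣≤ (proj₁ r)
      ; white      = d∈′
      ; extends    = exchange-extends
      ; unreached  = λ cu → x∈∁p⇒x∉p (component-⊆ d∈ cu) (proj₁ r)
      ; reached    = component-snoc d∈′ (exchange-extends c) (symm u~z)
          (u∈∁exchange {B = B} (λ u≡v → irrefl u≡v (proj₁ (proj₂ (proj₂ r)))))
      }

    -- The only vertex that turns white is `u`, and it has no neighbour in D.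
    exchange-preserves : ¬ Adjacent B d u →
                         ∀ {x} → InComponent G (∁ B′) d x → InComponent G (∁ B) d x
    exchange-preserves ¬adj = invariant (InComponent G (∁ B) d) inside-D ε
      where
      inside-D : ∀ {a b} → InComponent G (∁ B) d a → InducedAdj G (∁ B′) a b →
                 InComponent G (∁ B) d b
      inside-D ca ((_ , b∈) , a~b) with ∁-exchange⁻ {B = B} b∈
      ... | _ , inj₁ refl = contradiction (adjacent ca (symm a~b)) ¬adj
      ... | _ , inj₂ b∈∁  = component-snoc d∈ ca a~b b∈∁

  -- A white walk from `w` cannot leave the old component through `u`, whose only neighbour there is
  -- the now blue `v`. So the new component of `w` lies in the old one and misses `v`.
  exchange-shrinks : ∀ {B u v w} → Psd B u v → InComponent G (∁ B) v w → w ≢ v →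
                     component (∁ (exchange B u v)) w ⊂ component (∁ B) v
  exchange-shrinks {B} {u} {v} {w} (u∈ , v∈ , u~v , only) cw w≢v =
      (λ x∈ → ∈-component⁺ (proj₁ (within (∈-component⁻ x∈))))
    , v , ∈-component⁺ ε
    , (λ v∈′ → proj₂ (within (∈-component⁻ v∈′)) refl)
    where
    B′ = exchange B u v

    within : ∀ {x} → InComponent G (∁ B′) w x → InComponent G (∁ B) v x × x ≢ v
    within = invariant (λ x → InComponent G (∁ B) v x × x ≢ v) next (cw , w≢v)
      where
      next : ∀ {a b} → InComponent G (∁ B) v a × a ≢ v → InducedAdj G (∁ B′) a b →
             InComponent G (∁ B) v b × b ≢ v
      next (ca , a≢v) ((_ , b∈) , a~b) with ∁-exchange⁻ {B = B} b∈
      ... | _   , inj₁ refl = contradiction (only _ ca (symm a~b)) a≢v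
      ... | b≢v , inj₂ b∈∁  = component-snoc v∈ ca a~b b∈∁ , b≢v

  -- The vertex `r` bridges D and the component of `y`. The recursion is on that component: an
  -- exchange that leaves D unchanged passes to a strictly smaller component which `r` still meets.
  enlarge : ∀ {B d r y} → Percolates Psd B → d ∈ ∁ B → Adjacent B d r → r ∈ B →
            r ~ y → y ∈ ∁ B → ¬ InComponent G (∁ B) d y →
            Acc _⊂_ (component (∁ B) y) → Enlargement B d
  enlarge {B} {d} {r} {y} perc d∈ adj@(adjacent cz r~z) r∈ r~y y∈ ¬cy (acc rec)
    with force-in-component perc y∈
  ... | u , v , cv , p
    with adjacent? B d u
  ... | yes adj-u = exchange-enlarges d∈ p (λ c → ¬cy (c ◅◅ component-sym cv)) perc adj-u
  ... | no ¬adj-u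
    with any? (λ w → inComponent? (∁ B) v w ×-dec (r ~? w) ×-dec ¬? (w ≟ v))
  -- Here `v` is the only neighbour of `r` in the component of `y`, so `r` forces `v` too and can be
  -- exchanged in place of `u`.
  ... | no none = exchange-enlarges d∈ rv (λ c → ¬cy (c ◅◅ component-sym cv)) perc adj
    where
    only : ∀ w → InComponent G (∁ B) v w → r ~ w → w ≡ v
    only w c r~w = decidable-stable (w ≟ v) (λ w≢v → none (w , c , r~w , w≢v))

    rv : Psd B r v
    rv = r∈ , component-⊆ y∈ cv , subst (r ~_) (only y (component-sym cv) r~y) r~y , only
  -- Exchange `u` for `v` and continue with `w` in the role of `y`. Since `r` is adjacent to D and
  -- `u` is not, `r` stays blue and still bridges.
  ... | yes (w , cw , r~w , w≢v) = record
    { percolates = E.percolates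
    ; size       = ≤-trans E.size (∣exchange∣≤ (proj₁ p))
    ; white      = E.white
    ; extends    = E.extends ∘ exchange-extends d∈ p ¬dv
    ; unreached  = E.unreached ∘ exchange-extends d∈ p ¬dv
    ; reached    = E.reached
    }
    where
    B₁ = exchange B u v

    ¬dv : ¬ InComponent G (∁ B) d v
    ¬dv c = ¬cy (c ◅◅ component-sym cv)

    r≢u : r ≢ u
    r≢u refl = ¬adj-u adj

    shrinks : component (∁ B₁) w ⊂ component (∁ B) y
    shrinks with exchange-shrinks p cw w≢v
    ... | sub , x , x∈ , x∉ = v⊆y ∘ sub , x , v⊆y x∈ , x∉
      where
      v⊆y : component (∁ B) v ⊆ component (∁ B) y
      v⊆y x∈ = ∈-component⁺
        (cv ◅◅ ∈-component⁻ x∈)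

    e : Enlargement B₁ d
    e = enlarge (exchange-percolates p perc)
          (∁-exchange {B = B} d∈ (λ { refl → ¬dv ε }))
          (adjacent (exchange-extends d∈ p ¬dv cz) r~z)
          (∈-exchange r∈ r≢u) r~w
          (∁-exchange {B = B} (component-⊆ (component-⊆ y∈ cv) cw) w≢v)
          (λ c → ¬cy (exchange-preserves d∈ p ¬dv ¬adj-u c ◅◅ component-sym (cv ◅◅ cw)))
          (rec shrinks)

    module E = Enlargement e

  -- Once `b` is white, its component avoids D, as `b` has no neighbour in D. All other white
  -- neighbours of `a` lie in D, so `a` forces `b`.
  removal-percolates : ∀ {B d a b} → Percolates Psd B → d ∈ ∁ B → a ∈ B → a ~ b →
                       (∀ {w} → w ∈ ∁ B → a ~ w → InComponent G (∁ B) d w) →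
                       ¬ Adjacent B d b → b ∈ B → Percolates Psd (B - b)
  removal-percolates {B} {d} {a} {b} perc d∈ a∈ a~b in-D ¬adj-b b∈ =
    percolates-unforce psd-adm forces (percolates-⊆ incl perc)
    where
    incl : B ⊆ (B - b) ∪ ⁅ b ⁆
    incl {x} x∈B with x ≟ b
    ... | yes refl = x∈p∪q⁺ (inj₂ (x∈⁅x⁆ b))
    ... | no  x≢b  = x∈p∪q⁺ (inj₁ (x∈p∧x≢y⇒x∈p-y x∈B x≢b))

    white⁻ : ∀ {x} → x ∈ ∁ (B - b) → x ≢ b → x ∈ ∁ B
    white⁻ x∈ x≢b = x∉p⇒x∈∁p (λ x∈B → x∈∁p⇒x∉p x∈ (x∈p∧x≢y⇒x∈p-y x∈B x≢b))

    b∈∁ : b ∈ ∁ (B - b)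
    b∈∁ = x∉p⇒x∈∁p (λ b∈- → x∈p─q⇒x∉q {p = B} b∈- (x∈⁅x⁆ b))

    outside-D : ∀ {x y} → ¬ InComponent G (∁ B) d x → InducedAdj G (∁ (B - b)) x y →
                ¬ InComponent G (∁ B) d y
    outside-D {x} x∉D ((x∈ , _) , x~y) cy with x ≟ b
    ... | yes refl = ¬adj-b (adjacent cy x~y)
    ... | no  x≢b  = x∉D (component-snoc d∈ cy (symm x~y) (white⁻ x∈ x≢b))

    only : ∀ w → InComponent G (∁ (B - b)) b w → a ~ w → w ≡ b
    only w c a~w = decidable-stable (w ≟ b) (λ w≢b →
      invariant (¬_ ∘ InComponent G (∁ B) d) outside-D
        (λ cb → x∈∁p⇒x∉p (component-⊆ d∈ cb) b∈) c
        (in-D (white⁻ (component-⊆ b∈∁ c) w≢b) a~w))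

    forces : Psd (B - b) a b
    forces = x∈p∧x≢y⇒x∈p-y a∈ (λ a≡b → irrefl a≡b a~b) , b∈∁ , a~b , only

  -- Minimum percolating sets with connected white set

  WhiteConnected : Subset n → Set
  WhiteConnected B = ∀ {x y} → x ∈ ∁ B → y ∈ ∁ B → InComponent G (∁ B) x y

  module _ (conn : Connected G) {k} (min : ∀ B → Percolates Psd B → k ≤ ∣ B ∣) where

    -- Each enlargement makes the component of `d` strictly larger, so the recursion ends at a set
    -- without bridges from D to another white component.
    make-white-connected :
      ∀ {B d} → Percolates Psd B → ∣ B ∣ ≤ k → d ∈ ∁ B → Acc _⊃_ (component (∁ B) d) →
      ∃ λ B′ → Percolates Psd B′ × ∣ B′ ∣ ≤ k × WhiteConnected B′
    make-white-connected {B} {d} perc size d∈ (acc rec)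
      with any? (λ r → any? (λ y → (r ∈? B) ×-dec adjacent? B d r ×-dec (y ∈? ∁ B)
                                   ×-dec (r ~? y) ×-dec ¬? (inComponent? (∁ B) d y)))
    ... | yes (r , y , r∈ , adj , y∈ , r~y , ¬cy) =
      make-white-connected E.percolates (≤-trans E.size size) E.white
        (rec ( ∈-component⁺ ∘ E.extends ∘ ∈-component⁻
             , E.fresh , ∈-component⁺ E.reached , E.unreached ∘ ∈-component⁻))
      where
      module E = Enlargement (enlarge perc d∈ adj r∈ r~y y∈ ¬cy (⊂-wellFounded _))
    ... | no no-bridge
      with any? (λ a → any? (λ b → (a ∈? B) ×-dec (b ∈? B) ×-dec (a ~? b)
                                   ×-dec adjacent? B d a ×-dec ¬? (adjacent? B d b)))
    -- The set `B - b` would percolate with fewer than `k` elements.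
    ... | yes (a , b , a∈ , b∈ , a~b , adj , ¬adj) = contradiction
      (min (B - b) (removal-percolates perc d∈ a∈ a~b
        (λ {w} w∈ a~w → decidable-stable (inComponent? (∁ B) d w)
          (λ ¬cw → no-bridge (a , w , a∈ , adj , w∈ , a~w , ¬cw)))
        ¬adj b∈))
      (<⇒≱ (≤-trans (x∈p⇒∣p-x∣<∣p∣ b∈) size))
    ... | no no-redundant = B , perc , size ,
      λ x∈ y∈ → component-sym (reached x∈) ◅◅ reached y∈
      where
      -- D together with its blue neighbours. With neither a bridge nor a redundant vertex this set
      -- is closed under adjacency, hence contains every vertex of the connected graph.
      Near : Pred (Fin n) 0ℓ
      Near x = InComponent G (∁ B) d x ⊎ (x ∈ B × Adjacent B d x)

      near-step : ∀ {x y} → Near x → x ~ y → Near y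
      near-step {x} {y} near x~y with y ∈? B
      near-step (inj₁ cx) x~y | yes y∈B = inj₂ (y∈B , adjacent cx (symm x~y))
      near-step (inj₁ cx) x~y | no  y∉B = inj₁ (component-snoc d∈ cx x~y (x∉p⇒x∈∁p y∉B))
      near-step {x} {y} (inj₂ (x∈B , adj)) x~y | yes y∈B =
        inj₂ (y∈B , decidable-stable (adjacent? B d y)
          (λ ¬adj → no-redundant (x , y , x∈B , y∈B , x~y , adj , ¬adj)))
      near-step {x} {y} (inj₂ (x∈B , adj)) x~y | no y∉B =
        inj₁ (decidable-stable (inComponent? (∁ B) d y)
          (λ ¬cy → no-bridge (x , y , x∈B , adj , x∉p⇒x∈∁p y∉B , x~y , ¬cy)))

      near : ∀ {x y} → Near x → Star _~_ x y → Near y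
      near nx ε        = nx
      near nx (e ◅ es) = near (near-step nx e) es

      reached : ∀ {x} → x ∈ ∁ B → InComponent G (∁ B) d x
      reached {x} x∈ with near (inj₁ ε) (conn d x)
      ... | inj₁ c        = c
      ... | inj₂ (x∈B , _) = contradiction x∈B (x∈∁p⇒x∉p x∈)

  -- Claws, and white connectivity under forcing

  induced-star : ∀ {m c} (leaf : Fin m → Fin n) → (∀ i → c ~ leaf i) →
                 Injective _≡_ _≡_ leaf → (∀ i j → ¬ leaf i ~ leaf j) →
                 IsInducedSubgraph (K₁, m) G
  induced-star {m} {c} leaf spoke leaf-inj indep =
    f , (λ {i} {j} → inj i j) , λ i j → mk⇔ (to i j) (from i j)
    where
    f : Fin (suc m) → Fin n
    f zero    = c
    f (suc i) = leaf i

    inj : ∀ i j → f i ≡ f j → i ≡ j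
    inj zero    zero    _  = refl
    inj zero    (suc j) eq = contradiction (spoke j) (irrefl eq)
    inj (suc i) zero    eq = contradiction (spoke i) (irrefl (sym eq))
    inj (suc i) (suc j) eq = cong suc (leaf-inj eq)

    to : ∀ i j → Graph._~_ (K₁, m) i j → f i ~ f j
    to zero    (suc j) _ = spoke j
    to (suc i) zero    _ = symm (spoke i)
    to zero    zero    (inj₁ (_ , 0≢0)) = contradiction refl 0≢0
    to zero    zero    (inj₂ (0≢0 , _)) = contradiction refl 0≢0
    to (suc i) (suc j) (inj₁ (() , _))
    to (suc i) (suc j) (inj₂ (_ , ()))

    from : ∀ i j → f i ~ f j → Graph._~_ (K₁, m) i j
    from zero    zero    c~c = contradiction c~c (irrefl refl)
    from zero    (suc j) _   = inj₁ (refl , λ ())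
    from (suc i) zero    _   = inj₂ ((λ ()) , refl)
    from (suc i) (suc j) i~j = contradiction i~j (indep i j)

  claw-free-neighbours : ClawFree G → ∀ {c x y z} → c ~ x → c ~ y → c ~ z →
                         x ≢ y → x ≢ z → ¬ x ~ y → ¬ x ~ z → y ≡ z ⊎ y ~ z
  claw-free-neighbours free {c} {x} {y} {z} cx cy cz x≢y x≢z ¬xy ¬xz
    with y ≟ z | y ~? z
  ... | yes y≡z | _       = inj₁ y≡z
  ... | no  _   | yes y~z = inj₂ y~z
  ... | no  y≢z | no ¬yz  =
    contradiction (induced-star leaf spoke (λ {i} {j} → inj i j) indep) free
    where
    leaf : Fin 3 → Fin n
    leaf zero             = x
    leaf (suc zero)       = y
    leaf (suc (suc zero)) = z

    spoke : ∀ i → c ~ leaf i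
    spoke zero             = cx
    spoke (suc zero)       = cy
    spoke (suc (suc zero)) = cz

    inj : ∀ i j → leaf i ≡ leaf j → i ≡ j
    inj zero             zero             _  = refl
    inj zero             (suc zero)       eq = contradiction eq x≢y
    inj zero             (suc (suc zero)) eq = contradiction eq x≢z
    inj (suc zero)       zero             eq = contradiction (sym eq) x≢y
    inj (suc zero)       (suc zero)       _  = refl
    inj (suc zero)       (suc (suc zero)) eq = contradiction eq y≢z
    inj (suc (suc zero)) zero             eq = contradiction (sym eq) x≢z
    inj (suc (suc zero)) (suc zero)       eq = contradiction (sym eq) y≢z
    inj (suc (suc zero)) (suc (suc zero)) _  = refl

    indep : ∀ i j → ¬ leaf i ~ leaf j
    indep zero             zero             = irrefl refl
    indep zero             (suc zero)       = ¬xy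
    indep zero             (suc (suc zero)) = ¬xz
    indep (suc zero)       zero             = ¬xy ∘ symm
    indep (suc zero)       (suc zero)       = irrefl refl
    indep (suc zero)       (suc (suc zero)) = ¬yz
    indep (suc (suc zero)) zero             = ¬xz ∘ symm
    indep (suc (suc zero)) (suc zero)       = ¬yz ∘ symm
    indep (suc (suc zero)) (suc (suc zero)) = irrefl refl

  force-white-connected : ClawFree G → ∀ {B u v} → Std B u v →
                          WhiteConnected B → WhiteConnected (B ∪ ⁅ v ⁆)
  force-white-connected free {B} {u} {v} (u∈ , v∈ , u~v , only) wc x∈ y∈ =
    avoid x∈ y∈ (wc (proj₁ (white⁻ x∈)) (proj₁ (white⁻ y∈)))
    where
    W′ = ∁ (B ∪ ⁅ v ⁆)

    white⁻ : ∀ {x} → x ∈ W′ → x ∈ ∁ B × x ≢ v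
    white⁻ x∈ =
        x∉p⇒x∈∁p (λ x∈B → x∈∁p⇒x∉p x∈ (x∈p∪q⁺ (inj₁ x∈B)))
      , (λ { refl → x∈∁p⇒x∉p x∈ (x∈p∪q⁺ (inj₂ (x∈⁅x⁆ v))) })

    white⁺ : ∀ {x} → x ∈ ∁ B → x ≢ v → x ∈ W′
    white⁺ x∈ x≢v = x∉p⇒x∈∁p
      ([ x∈∁p⇒x∉p x∈ , x≢v ∘ x∈⁅y⁆⇒x≡y v ]′ ∘ x∈p∪q⁻ B ⁅ v ⁆)

    -- Claw-freeness at the centre `v` with `u` as one leaf: `v` is the only white neighbour of `u`,
    -- so `u` is adjacent to neither `p` nor `q`.
    clique : ∀ {p q} → p ∈ W′ → q ∈ W′ → v ~ p → v ~ q → p ≡ q ⊎ p ~ q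
    clique p∈ q∈ v~p v~q =
      claw-free-neighbours free (symm u~v) v~p v~q (u≢ p∈) (u≢ q∈) (u≁ p∈) (u≁ q∈)
      where
      u≢ : ∀ {p} → p ∈ W′ → u ≢ p
      u≢ p∈ refl = x∈∁p⇒x∉p (proj₁ (white⁻ p∈)) u∈

      u≁ : ∀ {p} → p ∈ W′ → ¬ u ~ p
      u≁ p∈ u~p = proj₂ (white⁻ p∈) (only _ (proj₁ (white⁻ p∈)) u~p)

    -- A passage p – v – q is shortcut to p – q or removed.
    avoid : ∀ {x y} → x ∈ W′ → y ∈ W′ → InComponent G (∁ B) x y → InComponent G W′ x y
    avoid x∈ y∈ ε = ε
    avoid x∈ y∈ (_◅_ {j = p} ((_ , p∈) , x~p) c) with p ≟ v
    avoid x∈ y∈ (((_ , p∈) , x~p) ◅ c) | no p≢v =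
      ((x∈ , white⁺ p∈ p≢v) , x~p) ◅ avoid (white⁺ p∈ p≢v) y∈ c
    avoid x∈ y∈ (_ ◅ ε) | yes refl = contradiction refl (proj₂ (white⁻ y∈))
    avoid x∈ y∈ ((_ , x~v) ◅ ((_ , q∈) , v~q) ◅ c) | yes refl
      with q∈′ ← white⁺ q∈ (λ q≡v → irrefl (sym q≡v) v~q)
      with clique x∈ q∈′ (symm x~v) v~q
    ... | inj₁ refl = avoid x∈ y∈ c
    ... | inj₂ x~q  = ((x∈ , q∈′) , x~q) ◅ avoid q∈′ y∈ c

  -- With a connected white set, the component of `v` is the whole white set, so a positive
  -- semidefinite force is a standard one. Performing it keeps the white set connected, and the
  -- recursion continues from the larger blue set.
  white-connected-standard : ClawFree G → ∀ {B} → WhiteConnected B →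
                             Percolates Psd B → Percolates Std B
  white-connected-standard free {B} = go B (⊃-wellFounded B)
    where
    go : ∀ B → Acc _⊃_ B → WhiteConnected B → Percolates Psd B → Percolates Std B
    go B (acc rec) wc perc with any? (_∈? ∁ B)
    ... | no none = all-blue-percolates (λ x x∈ → none (x , x∈))
    ... | yes (y , y∈) with percolates-force psd-adm perc id (x∈∁p⇒x∉p y∈)
    ...   | u , v , u∈ , v∈ , u~v , only =
      percolates-unforce std-adm r
        (go (B ∪ ⁅ v ⁆)
          (rec (p⊆p∪q ⁅ v ⁆ , v , x∈p∪q⁺ (inj₂ (x∈⁅x⁆ v)) , x∈∁p⇒x∉p v∈))
          (force-white-connected free r wc)
          (percolates-⊆ (p⊆p∪q ⁅ v ⁆) perc))
      where
      r : Std B u v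
      r = u∈ , v∈ , u~v , λ w w∈ → only w (wc v∈ w∈)

  -- Comparison of the two forcing numbers

  psd-min⇒standard : Connected G → ClawFree G → ∀ {k} →
                     (∀ B → Percolates Psd B → k ≤ ∣ B ∣) →
                     ∀ {B} → Percolates Psd B → ∣ B ∣ ≤ k →
                     ∃ λ B′ → Percolates Std B′ × ∣ B′ ∣ ≤ k
  psd-min⇒standard conn free min {B} perc size with any? (_∈? ∁ B)
  ... | no none = B , all-blue-percolates (λ x x∈ → none (x , x∈)) , size
  ... | yes (d , d∈) with make-white-connected conn min perc size d∈ (⊃-wellFounded _)
  ...   | B′ , perc′ , size′ , wc = B′ , white-connected-standard free wc perc′ , size′

  -- White components consist of white vertices, so every standard force is a positive semidefinite
  -- force, and sets stalled for the latter rule are stalled for the former.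
  standard⇒psd : ∀ {B} → Percolates Std B → Percolates Psd B
  standard⇒psd perc S B⊆S st = perc S B⊆S λ { u v (u∈ , v∈ , u~v , only) →
    st u v (u∈ , v∈ , u~v , λ w c → only w (component-⊆ v∈ c)) }

  forcing-numbers-agree : Connected G → ClawFree G → ∀ {k l} →
                          IsForcingNumber Psd k → IsForcingNumber Std l → k ≡ l
  forcing-numbers-agree conn free {k} {l} psd-num std-num = ≤-antisym k≤l l≤k
    where
    open IsForcingNumber

    psd-min : ∀ B → Percolates Psd B → k ≤ ∣ B ∣
    psd-min B perc = minimal psd-num B (percolates⇒forcing psd-adm perc)

    k≤l : k ≤ l
    k≤l with minimal-percolating std-adm std-num
    ... | B , perc , size = ≤-trans (psd-min B (standard⇒psd perc)) size

    l≤k : l ≤ k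
    l≤k with minimal-percolating psd-adm psd-num
    ... | B , perc , size with psd-min⇒standard conn free psd-min perc size
    ...   | B′ , perc′ , size′ =
      ≤-trans (minimal std-num B′ (percolates⇒forcing std-adm perc′)) size′

theorem5 : ∀ (n : ℕ) (G : Graph n) → Connected G → ClawFree G → Z₊ G ≡ Z G
theorem5 n G conn free =
  forcing-numbers-agree G conn free (proj₂ (Z₊-spec G)) (proj₂ (Z-spec G))
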